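{- Let $t\ge 1$ be an integer and let $G$ be a $\chi_t$-critical graph whose $t$-complement $\overline{G}^t$ is connected. Then $|G|\ge 2\chi_t(G)-1$. Equivalently: if $G$ is a $\chi_t$-critical graph with $|G|\le 2\chi_t(G)-2$, then $G$ is $t$-decomposable, i.e. there are two non-empty disjoint subgraphs $G_1,G_2$ of $G$ such that $G$ is obtained from $G_1\cup G_2$ by joining each vertex of $G_1$ to each vertex of $G_2$ by exactly $t$ parallel edges.
   Context: All graphs are finite, undirected, loopless, and may have multiple edges; $|G|$ is the number of vertices and degrees count edges with multiplicity. $\mu_G(u,v)$ is the number of edges joining $u$ and $v$, and $\mu(G)=\max_{u\ne v}\mu_G(u,v)$. For an integer $t\ge1$, a graph is strictly $t$-degenerate if every non-empty subgraph $H$ of it has a vertex of degree at most $t-1$ in $H$. The point partition number $\chi_t(G)$ is the least $k\ge 0$ such that $V(G)$ can be colored with $k$ colors so that each color class induces a strictly $t$-degenerate subgraph. $G$ is $\chi_t$-critical if $\chi_t(G')<\chi_t(G)$ for every proper subgraph $G'$ of $G$. For a graph $G$ with $\mu(G)\le t$, the $t$-complement $\overline{G}^t$ is the graph on $V(G)$ with $\mu_{\overline{G}^t}(u,v)=t-\mu_G(u,v)$ for all distinct $u,v$. Such a $G$ is $t$-decomposable if it is the Dirac $t$-join of two non-empty disjoint subgraphs $G_1,G_2$, meaning $G$ arises from the disjoint union $G_1\cup G_2$ by adding edges so that $\mu_G(u,v)=t$ for all $u\in V(G_1)$, $v\in V(G_2)$ (equivalently, $\overline{G}^t$ is disconnected).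 (A $\chi_t$-critical graph satisfies $\mu(G)\le t$.) -}

module Defs where

open import Data.Nat using (ℕ; zero; suc; _+_; _*_; _∸_; _≤_; _<_)
open import Data.Fin using (Fin; _≟_)
import Data.Fin as F
open import Data.Bool using (Bool; true; false; if_then_else_; _∧_)
open import Data.Product using (Σ; ∃; _×_; _,_)
open import Relation.Nullary using (¬_)
open import Relation.Nullary.Decidable using (⌊_⌋)
open import Relation.Binary.PropositionalEquality using (_≡_; _≢_; refl)

sumF : ∀ {n} → (Fin n → ℕ) → ℕ
sumF {zero}  f = 0
sumF {suc n} f = f F.zero + sumF (λ i → f (F.suc i))

-- A (multi)graph whose vertex set is a subset V of Fin n, with edge
-- multiplicity function μ.  Well-formedness is the predicate WF below.
record MGraph (n : ℕ) : Set where
  constructor mkG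
  field
    V : Fin n → Bool
    μ : Fin n → Fin n → ℕ
open MGraph public

WF : ∀ {n} → MGraph n → Set
WF G = (∀ u v → μ G u v ≡ μ G v u)
     × (∀ v → μ G v v ≡ 0)
     × (∀ u v → V G u ≡ false → μ G u v ≡ 0)

order : ∀ {n} → MGraph n → ℕ
order G = sumF (λ v → if V G v then 1 else 0)

deg : ∀ {n} → MGraph n → Fin n → ℕ
deg G v = sumF (λ u → μ G u v)

NonEmpty : ∀ {n} → MGraph n → Set
NonEmpty G = ∃ λ v → V G v ≡ true

_⊆G_ : ∀ {n} → MGraph n → MGraph n → Set
H ⊆G G = (∀ v → V H v ≡ true → V G v ≡ true) × (∀ u v → μ H u v ≤ μ G u v)

SameG : ∀ {n} → MGraph n → MGraph n → Set
SameG H G = (∀ v → V H v ≡ V G v) × (∀ u v → μ H u v ≡ μ G u v)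

ProperSub : ∀ {n} → MGraph n → MGraph n → Set
ProperSub H G = WF H × H ⊆G G × ¬ SameG H G

induce : ∀ {n} → MGraph n → (Fin n → Bool) → MGraph n
induce G P = mkG (λ v → V G v ∧ P v)
                 (λ u v → if P u ∧ P v then μ G u v else 0)

StrictlyDegenerate : ℕ → ∀ {n} → MGraph n → Set
StrictlyDegenerate t {n} H =
  (K : MGraph n) → WF K → K ⊆G H → NonEmpty K →
  ∃ λ v → V K v ≡ true × suc (deg K v) ≤ t

-- membership of a vertex (whose V-flag is b) in colour class c
inClass : ∀ {k} (b : Bool) → (b ≡ true → Fin k) → Fin k → Bool
inClass true  g c = ⌊ g refl ≟ c ⌋
inClass false g c = false

Colourable : ℕ → ∀ {n} → MGraph n → ℕ → Set
Colourable t {n} G k =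
  Σ ((v : Fin n) → V G v ≡ true → Fin k) λ f →
    (c : Fin k) → StrictlyDegenerate t (induce G (λ v → inClass (V G v) (f v) c))

IsChi : ℕ → ∀ {n} → MGraph n → ℕ → Set
IsChi t G k = Colourable t G k × (∀ j → Colourable t G j → k ≤ j)

Critical : ℕ → ∀ {n} → MGraph n → Set
Critical t {n} G = (H : MGraph n) → ProperSub H G →
  ∀ a b → IsChi t H a → IsChi t G b → a < b

data Reach {n} (E : Fin n → Fin n → Set) : Fin n → Fin n → Set where
  here : ∀ {u} → Reach E u u
  step : ∀ {u v w} → E u v → Reach E v w → Reach E u w

-- edges of the t-complement: multiplicity t - μ(u,v) between distinct vertices
tCompEdge : ℕ → ∀ {n} → MGraph n → Fin n → Fin n → Set
tCompEdge t G u v = V G u ≡ true × V G v ≡ true × u ≢ v × 0 < t ∸ μ G u v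

TCompConnected : ℕ → ∀ {n} → MGraph n → Set
TCompConnected t G = ∀ u v → V G u ≡ true → V G v ≡ true → Reach (tCompEdge t G) u v

{-# OPTIONS --safe #-}
module Submission where

-- Colour classes that may be used are the vertex sets inducing strictly t-degenerate subgraphs; they form
-- a simplicial complex whose edges are exactly the edges of the t-complement, and χ_t is its covering
-- number χ.  It is therefore enough to show |V| ≥ 2χ(V) − 1 for a complex whose 1-skeleton is connected and
-- for which deleting any vertex lowers χ.
--
-- Induct on |V|.  Pick a ∈ V and let U ⊆ V − a be minimal with χ(U) = χ(V) − 1; put A = V ∖ U.  The connected
-- components P_1, …, P_q of U are again critical, so by induction 2χ(P_b) ≤ |P_b| + 1, and adding up,
-- 2χ(V) − 2 ≤ |U| + q.  If the bound failed for V, this would give |A| ≤ q.  Each P_b has a neighbour in A by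
-- connectedness, so alternating paths yield a non-empty S ⊆ A and a family Q of components such that no vertex
-- of A ∖ S is adjacent to a component in Q, and S can be matched into Q along edges.  For a ∈ S, a cover of
-- V − a by χ(V) − 1 faces splits into covers of the components in Q and of the remaining vertices.  By
-- criticality of P_b, covering P_b together with its partner in S needs no more faces than covering P_b.  So
-- V has a cover by χ(V) − 1 faces, a contradiction.
open import Defs
open import Data.Nat using (ℕ; zero; suc; _+_; _*_; _∸_; _≤_; _<_; z≤n; s≤s; s≤s⁻¹; _≤?_)
open import Data.Nat.Properties
  using (≤-refl; ≤-trans; ≤-reflexive; ≤-<-trans; <-≤-trans; <⇒≱; ≰⇒>; n<1+n; m≤n⇒m<n∨m≡n; m<n⇒n≢0; m∸n≢0⇒n<m;
         +-suc; +-identityʳ; +-comm; +-mono-≤; +-monoˡ-≤; +-monoʳ-≤; +-cancelˡ-≤; +-cancelʳ-≤; ∸-monoˡ-≤;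
         *-suc; *-distribˡ-+; *-monoʳ-≤; +-commutativeSemigroup; module ≤-Reasoning)
open import Data.Nat.Induction using (<-wellFounded)
open import Algebra.Properties.CommutativeSemigroup +-commutativeSemigroup using (interchange)
open import Induction.WellFounded using (Acc; acc)
open import Data.Bool using (Bool; true; false; if_then_else_; _∧_; not)
open import Data.Bool.Properties using (∧-identityʳ)
open import Data.Fin using (Fin; zero; suc; splitAt; _↑ˡ_; _↑ʳ_; fromℕ<)
open import Data.Fin.Properties
  using (_≟_; any?; all?; suc-injective; splitAt⁻¹-↑ˡ; splitAt⁻¹-↑ʳ; splitAt-↑ˡ; splitAt-↑ʳ)
open import Data.Fin.Subset
  using (Subset; ⊥; ⊤; ⁅_⁆; _∈_; _∉_; _⊆_; _∪_; _─_; _-_; ∣_∣; Nonempty; inside; outside; ⋃)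
open import Data.Fin.Subset.Properties
open import Data.List as List using ()
open import Data.Vec using ([]; _∷_; here; there; lookup; tabulate)
open import Data.Vec.Properties using (lookup∘tabulate; []=⇒lookup; lookup⇒[]=)
open import Data.Product using (∃; _×_; _,_; proj₁; proj₂)
open import Data.Sum using (_⊎_; inj₁; inj₂; [_,_]; [_,_]′)
open import Function using (_∘_; id; case_of_)
open import Relation.Nullary using (¬_; Dec; yes; no; contradiction)
open import Relation.Nullary.Decidable using (⌊_⌋; _×-dec_; _→-dec_; ¬?; decidable-stable; ¬¬-excluded-middle)
open import Relation.Binary.PropositionalEquality using (_≡_; _≢_; refl; sym; trans; cong; cong₂; subst)

-- Finite subsets, least witnesses and double-negated comprehension.

x∈p─q⇒x∉q : ∀ {n} {x : Fin n} (p q : Subset n) → x ∈ p ─ q → x ∉ q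
x∈p─q⇒x∉q (_ ∷ p) (outside ∷ q) (there x∈) (there x∈q) = x∈p─q⇒x∉q p q x∈ x∈q
x∈p─q⇒x∉q (_ ∷ p) (inside ∷ q) (there x∈) (there x∈q) = x∈p─q⇒x∉q p q x∈ x∈q

∣q∣+∣p─q∣≤∣p∣ : ∀ {n} (p q : Subset n) → q ⊆ p → ∣ q ∣ + ∣ p ─ q ∣ ≤ ∣ p ∣
∣q∣+∣p─q∣≤∣p∣ [] [] q⊆p = z≤n
∣q∣+∣p─q∣≤∣p∣ (inside ∷ p) (inside ∷ q) q⊆p = s≤s (∣q∣+∣p─q∣≤∣p∣ p q (drop-∷-⊆ q⊆p))
∣q∣+∣p─q∣≤∣p∣ (inside ∷ p) (outside ∷ q) q⊆p =
  ≤-trans (≤-reflexive (+-suc ∣ q ∣ ∣ p ─ q ∣)) (s≤s (∣q∣+∣p─q∣≤∣p∣ p q (drop-∷-⊆ q⊆p)))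
∣q∣+∣p─q∣≤∣p∣ (outside ∷ p) (inside ∷ q) q⊆p with () ← q⊆p here
∣q∣+∣p─q∣≤∣p∣ (outside ∷ p) (outside ∷ q) q⊆p = ∣q∣+∣p─q∣≤∣p∣ p q (drop-∷-⊆ q⊆p)

injective⇒≤∣p∣ : ∀ {n} q (p : Subset n) (h : Fin q → Fin n) → (∀ {i j} → h i ≡ h j → i ≡ j) →
  (∀ i → h i ∈ p) → q ≤ ∣ p ∣
injective⇒≤∣p∣ zero p h inj h∈ = z≤n
injective⇒≤∣p∣ (suc q) p h inj h∈ = ≤-<-trans
  (injective⇒≤∣p∣ q (p - h zero) (h ∘ suc) (suc-injective ∘ inj)
    (λ i → x∈p∧x≢y⇒x∈p-y (h∈ (suc i)) λ e → case inj e of λ ()))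
  (x∈p⇒∣p-x∣<∣p∣ (h∈ zero))

least : ∀ {P : ℕ → Set} → (∀ k → Dec (P k)) → ∀ k → P k → ∃ λ m → P m × (∀ j → P j → m ≤ j)
least P? zero p = zero , p , λ _ _ → z≤n
least {P} P? (suc k) p with P? zero
... | yes p₀ = zero , p₀ , λ _ _ → z≤n
... | no ¬p₀ with least (P? ∘ suc) k p
...   | m , pm , min = suc m , pm , λ { zero p₀ → contradiction p₀ ¬p₀ ; (suc j) pj → s≤s (min j pj) }

-- Serves to collect vertices by properties, such as reachability, that come without a decision
-- procedure. The final inequality is decidable, so a double-negated subset is enough.
¬¬-comprehension : ∀ {n} (P : Fin n → Set) →
  ¬ ¬ (∃ λ (S : Subset n) → (∀ {x} → x ∈ S → P x) × (∀ {x} → P x → x ∈ S))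
¬¬-comprehension {zero} P k = k ([] , (λ ()) , λ { {()} })
¬¬-comprehension {suc n} P k = ¬¬-comprehension (P ∘ suc) λ { (S , sound , complete) →
  ¬¬-excluded-middle λ
    { (yes p₀) → k (inside ∷ S , (λ { here → p₀ ; (there x∈) → sound x∈ }) ,
                    λ { {zero} _ → here ; {suc x} p → there (complete p) })
    ; (no ¬p₀) → k (outside ∷ S , (λ { (there x∈) → sound x∈ }) ,
                    λ { {zero} p → contradiction p ¬p₀ ; {suc x} p → there (complete p) }) } }

⊈⇒∃∉ : ∀ {n} {p q : Subset n} → ¬ (p ⊆ q) → ∃ λ x → x ∈ p × x ∉ q
⊈⇒∃∉ {p = p} {q} p⊈q = decidable-stable (any? λ x → (x ∈? p) ×-dec ¬? (x ∈? q)) λ none →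
  p⊈q λ {x} x∈ → decidable-stable (x ∈? q) λ x∉ → none (x , x∈ , x∉)

_[_≔_] : ∀ {n} {B : Set} → (Fin n → B) → Fin n → B → Fin n → B
(m [ a ≔ b ]) x with x ≟ a
... | yes _ = b
... | no _ = m x

-- Alternating rematchings and tight matchings in a bipartite relation.

module Matching {n q : ℕ} (E : Fin n → Fin q → Set) where

  record IsMatching (S : Subset n) (m : Fin n → Fin q) : Set where
    field
      edge : ∀ {a} → a ∈ S → E a (m a)
      inj : ∀ {a a'} → a ∈ S → a' ∈ S → m a ≡ m a' → a ≡ a'
  open IsMatching

  Free : Subset n → (Fin n → Fin q) → Fin q → Set
  Free S m b = ∀ {a} → a ∈ S → m a ≢ b

  -- Serves both for augmenting, where `a` joins `S`, and for rematching, where `a` already lies in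
  -- `S`.
  extend : ∀ {S S' m a b} → S' ⊆ S ∪ ⁅ a ⁆ → IsMatching S m → Free S m b → E a b →
    IsMatching S' (m [ a ≔ b ])
  extend {S} {S'} {m} {a} {b} S'⊆ matching free e = record { edge = edge' ; inj = inj' }
    where
    old : ∀ {x} → x ∈ S' → x ≢ a → x ∈ S
    old x∈ x≢a with x∈p∪q⁻ S ⁅ a ⁆ (S'⊆ x∈)
    ... | inj₁ x∈S = x∈S
    ... | inj₂ x∈a = contradiction (x∈⁅y⁆⇒x≡y a x∈a) x≢a
    edge' : ∀ {x} → x ∈ S' → E x ((m [ a ≔ b ]) x)
    edge' {x} x∈ with x ≟ a
    ... | yes refl = e
    ... | no x≢a = edge matching (old x∈ x≢a)
    inj' : ∀ {x y} → x ∈ S' → y ∈ S' → (m [ a ≔ b ]) x ≡ (m [ a ≔ b ]) y → x ≡ y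
    inj' {x} {y} x∈ y∈ eq with x ≟ a | y ≟ a
    ... | yes refl | yes refl = refl
    ... | yes refl | no y≢a = contradiction (sym eq) (free (old y∈ y≢a))
    ... | no x≢a | yes refl = contradiction eq (free (old x∈ x≢a))
    ... | no x≢a | no y≢a = inj matching (old x∈ x≢a) (old y∈ y≢a) eq

  -- Keeping the whole rematching m of S, with b left free, instead of an alternating path from b₀ to b
  -- avoids surgery on paths that are not simple.
  data Alternating (S : Subset n) (m₀ : Fin n → Fin q) (b₀ : Fin q) : (Fin n → Fin q) → Fin q → Set where
    start : Alternating S m₀ b₀ m₀ b₀
    move : ∀ {m a b} → Alternating S m₀ b₀ m b → a ∈ S → E a b → Alternating S m₀ b₀ (m [ a ≔ b ]) (m a)

  -- The vertex released by a move is free afterwards, because injectivity leaves no second vertex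
  -- of `S` matched to it.
  alternating-matching : ∀ {S m₀ b₀ m b} → IsMatching S m₀ → Free S m₀ b₀ →
    Alternating S m₀ b₀ m b → IsMatching S m × Free S m b
  alternating-matching matching free start = matching , free
  alternating-matching {S} matching free (move {m} {a} {b} r a∈ e)
    with matching' , free' ← alternating-matching matching free r
    = extend (p⊆p∪q ⁅ a ⁆) matching' free' e , free''
    where
    free'' : Free S (m [ a ≔ b ]) (m a)
    free'' {x} x∈ eq with x ≟ a
    ... | yes refl = free' a∈ (sym eq)
    ... | no x≢a = x≢a (inj matching' x∈ a∈ eq)

  -- The first move that rematches `a` releases its original partner `m₀ a`, which is thereby
  -- reached.
  alternating-unchanged : ∀ {S m₀ b₀ m b} → Alternating S m₀ b₀ m b → ∀ a →
    m a ≡ m₀ a ⊎ ∃ λ m' → Alternating S m₀ b₀ m' (m₀ a)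
  alternating-unchanged start x = inj₁ refl
  alternating-unchanged {S} {m₀} {b₀} r'@(move {m} {a} {b} r a∈ e) x with x ≟ a | alternating-unchanged r x
  ... | _ | inj₂ reached = inj₂ reached
  ... | no _ | inj₁ eq = inj₁ eq
  ... | yes refl | inj₁ eq = inj₂ (_ , subst (Alternating S m₀ b₀ _) eq r')

  -- The fields together make `S` exactly the neighbourhood of `Q` in `A`, matched injectively into
  -- `Q`.
  record TightMatching (A : Subset n) : Set where
    field
      S : Subset n
      Q : Subset q
      m : Fin n → Fin q
      S⊆A : S ⊆ A
      nonempty : Nonempty S
      matching : IsMatching S m
      m∈Q : ∀ {a} → a ∈ S → m a ∈ Q
      closed : ∀ {a b} → a ∈ A → b ∈ Q → E a b → a ∈ S

  -- Otherwise choosing preimages would inject all `q` vertices into `S`.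
  free-vertex : ∀ S m → ∣ S ∣ < q → ∃ (Free S m)
  free-vertex S m S<q with any? (λ b → all? (λ a → (a ∈? S) →-dec ¬? (m a ≟ b)))
  ... | yes (b , free) = b , λ {a} → free a
  ... | no ¬free = contradiction
    (injective⇒≤∣p∣ q S (proj₁ ∘ preimage)
      (λ {b} {c} eq → trans (sym (proj₂ (proj₂ (preimage b)))) (trans (cong m eq) (proj₂ (proj₂ (preimage c)))))
      (proj₁ ∘ proj₂ ∘ preimage))
    (<⇒≱ S<q)
    where
    preimage : ∀ b → ∃ λ a → a ∈ S × m a ≡ b
    preimage b = decidable-stable (any? λ a → (a ∈? S) ×-dec (m a ≟ b))
      λ none → ¬free (b , λ a a∈ eq → none (a , a∈ , eq))

  module _ {A : Subset n} (A≤q : ∣ A ∣ ≤ q) (A-nonempty : Nonempty A)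
    (neighbour : ∀ b → ¬ ¬ (∃ λ a → a ∈ A × E a b)) where

    -- `Q` collects the vertices reached from `b₀`, and `T` the vertices of `S` adjacent to `Q`.
    -- Without an augmenting path every neighbour of `Q` in `A` lies in `S`; a neighbour of `b₀`
    -- shows that `T` is non-empty.
    tight-of-maximal : ∀ {S m b₀} → S ⊆ A → IsMatching S m →
      ¬ (∃ λ m' → ∃ λ b → ∃ λ a → Alternating S m b₀ m' b × a ∈ A × a ∉ S × E a b) → ¬ ¬ TightMatching A
    tight-of-maximal {S} {m} {b₀} S⊆A matching ¬augment k =
      ¬¬-comprehension (λ b → ∃ λ m' → Alternating S m b₀ m' b) λ { (Q , Q-sound , Q-complete) →
      ¬¬-comprehension (λ a → a ∈ S × ∃ λ b → b ∈ Q × E a b) λ { (T , T-sound , T-complete) →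
      let in-S : ∀ {a b} → a ∈ A → b ∈ Q → E a b → a ∈ S
          in-S {a} {b} a∈ b∈ e = decidable-stable (a ∈? S) λ a∉ →
            ¬augment (_ , b , a , proj₂ (Q-sound b∈) , a∈ , a∉ , e)
          b₀∈Q = Q-complete (m , start)
      in neighbour b₀ λ { (a₀ , a₀∈ , e₀) → k (record
        { S = T ; Q = Q ; m = m
        ; S⊆A = S⊆A ∘ proj₁ ∘ T-sound
        ; nonempty = a₀ , T-complete (in-S a₀∈ b₀∈Q e₀ , b₀ , b₀∈Q , e₀)
        ; matching = record
          { edge = edge matching ∘ proj₁ ∘ T-sound
          ; inj = λ a∈ a'∈ → inj matching (proj₁ (T-sound a∈)) (proj₁ (T-sound a'∈)) }
        ; m∈Q = λ a∈ → Q-complete (partner (T-sound a∈) Q-sound)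
        ; closed = λ {a} {b} a∈ b∈ e → T-complete (in-S a∈ b∈ e , b , b∈ , e) }) } } }
      where
      -- Rematching `a` to `b` releases `m a`, unless `a` was rematched before, and then `m a` was
      -- reached earlier.
      partner : ∀ {a Q} → a ∈ S × (∃ λ b → b ∈ Q × E a b) →
        (∀ {b} → b ∈ Q → ∃ λ m' → Alternating S m b₀ m' b) → ∃ λ m' → Alternating S m b₀ m' (m a)
      partner {a} (a∈S , b , b∈ , e) Q-sound with Q-sound b∈
      ... | m' , r with alternating-unchanged r a
      ...   | inj₁ eq = _ , subst (Alternating S m b₀ _) eq (move r a∈S e)
      ...   | inj₂ reached = reached

    grow : ∀ S m → Acc _<_ ∣ A ─ S ∣ → S ⊆ A → IsMatching S m → ¬ ¬ TightMatching A
    grow S m (acc rec) S⊆A matching k with A ⊆? S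
    ... | yes A⊆S = k (record
      { S = S ; Q = ⊤ ; m = m ; S⊆A = S⊆A
      ; nonempty = proj₁ A-nonempty , A⊆S (proj₂ A-nonempty)
      ; matching = matching ; m∈Q = λ _ → ∈⊤ ; closed = λ a∈ _ _ → A⊆S a∈ })
    -- Here `S` has fewer than `q` elements, so some `b₀` is free: either an alternating path from
    -- it augments the matching, or the reached part is tight.
    ... | no A⊈S with b₀ , free ← free-vertex S m (<-≤-trans (p⊂q⇒∣p∣<∣q∣ (S⊆A , ⊈⇒∃∉ A⊈S)) A≤q) =
      tight-of-maximal S⊆A matching augment k
      where
      augment : ¬ (∃ λ m' → ∃ λ b → ∃ λ a → Alternating S m b₀ m' b × a ∈ A × a ∉ S × E a b)
      augment (m' , b , a , r , a∈ , a∉ , e) with matching' , free' ← alternating-matching matching free r =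
        grow (S ∪ ⁅ a ⁆) (m' [ a ≔ b ]) (rec smaller)
          (λ x∈ → [ S⊆A , (λ x∈a → subst (_∈ A) (sym (x∈⁅y⁆⇒x≡y a x∈a)) a∈) ]′ (x∈p∪q⁻ S ⁅ a ⁆ x∈))
          (extend id matching' free' e) k
        where
        smaller : ∣ A ─ (S ∪ ⁅ a ⁆) ∣ < ∣ A ─ S ∣
        smaller = subst (λ X → ∣ X ∣ < ∣ A ─ S ∣) (p─q─r≡p─q∪r A S ⁅ a ⁆) (x∈p⇒∣p-x∣<∣p∣ (x∈p∧x∉q⇒x∈p─q a∈ a∉))

    tight-matching : ¬ ¬ TightMatching A
    tight-matching = grow ⊥ (λ _ → b₀) (<-wellFounded _) ⊥⊆
      (record { edge = λ a∈ → contradiction a∈ ∉⊥ ; inj = λ a∈ → contradiction a∈ ∉⊥ })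
      where
      b₀ : Fin q
      -- `q` is positive because `A` is non-empty; the value is a placeholder partner for the empty
      -- matching.
      b₀ = fromℕ< (≤-trans (≤-<-trans z≤n (x∈p⇒∣p-x∣<∣p∣ (proj₂ A-nonempty))) A≤q)

-- Simplicial complexes: adjacency and covers by faces.

module Complex {n : ℕ} (Face : Subset n → Set) (Face? : ∀ S → Dec (Face S))
  (Face-⊆ : ∀ {S T} → S ⊆ T → Face T → Face S) (Face-⁅⁆ : ∀ x → Face ⁅ x ⁆) (Face-⊥ : Face ⊥) where

  Adj : Fin n → Fin n → Set
  Adj x y = Face (⁅ x ⁆ ∪ ⁅ y ⁆)

  ⁅⁆∪⁅⁆⊆ : ∀ {x y} {S : Subset n} → x ∈ S → y ∈ S → ⁅ x ⁆ ∪ ⁅ y ⁆ ⊆ S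
  ⁅⁆∪⁅⁆⊆ {x} {y} x∈ y∈ z∈ with x∈p∪q⁻ ⁅ x ⁆ ⁅ y ⁆ z∈
  ... | inj₁ z∈x rewrite x∈⁅y⁆⇒x≡y x z∈x = x∈
  ... | inj₂ z∈y rewrite x∈⁅y⁆⇒x≡y y z∈y = y∈

  Face⇒Adj : ∀ {F x y} → Face F → x ∈ F → y ∈ F → Adj x y
  Face⇒Adj face x∈ y∈ = Face-⊆ (⁅⁆∪⁅⁆⊆ x∈ y∈) face

  Adj-refl : ∀ x → Adj x x
  Adj-refl x = Face⇒Adj (Face-⁅⁆ x) (x∈⁅x⁆ x) (x∈⁅x⁆ x)

  Adj-sym : ∀ {x y} → Adj x y → Adj y x
  Adj-sym {x} {y} a = Face⇒Adj a (q⊆p∪q ⁅ x ⁆ ⁅ y ⁆ (x∈⁅x⁆ y)) (p⊆p∪q ⁅ y ⁆ (x∈⁅x⁆ x))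

  Adj? : ∀ x y → Dec (Adj x y)
  Adj? x y = Face? _

  -- Faces are removed one after the other, so that a search over subsets decides coverability; a
  -- face may stick out of `U`.
  Cov : ℕ → Subset n → Set
  Cov zero U = ∀ x → x ∉ U
  Cov (suc k) U = ∃ λ F → Face F × Cov k (U ─ F)

  Cov? : ∀ k U → Dec (Cov k U)
  Cov? zero U = all? (λ x → ¬? (x ∈? U))
  Cov? (suc k) U = anySubset? (λ F → Face? F ×-dec Cov? k (U ─ F))

  ─-monoˡ : ∀ {U W F : Subset n} → U ⊆ W → U ─ F ⊆ W ─ F
  ─-monoˡ {U} {W} {F} U⊆W x∈ = x∈p∧x∉q⇒x∈p─q (U⊆W (p─q⊆p U F x∈)) (x∈p─q⇒x∉q U F x∈)

  ∪-⊆ : ∀ {X Y W : Subset n} → X ⊆ W → Y ⊆ W → X ∪ Y ⊆ W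
  ∪-⊆ {X} {Y} X⊆ Y⊆ x∈ = [ X⊆ , Y⊆ ]′ (x∈p∪q⁻ X Y x∈)

  Cov-⊆ : ∀ k {U W} → U ⊆ W → Cov k W → Cov k U
  Cov-⊆ zero U⊆W empty x x∈ = empty x (U⊆W x∈)
  Cov-⊆ (suc k) U⊆W (F , face , c) = F , face , Cov-⊆ k (─-monoˡ U⊆W) c

  Cov-suc : ∀ k {U} → Cov k U → Cov (suc k) U
  Cov-suc k {U} c = ⊥ , Face-⊥ , Cov-⊆ k (p─q⊆p U ⊥) c

  Cov-≤ : ∀ {k l U} → k ≤ l → Cov k U → Cov l U
  Cov-≤ {k} {zero} z≤n c = c
  Cov-≤ {k} {suc l} k≤ c with m≤n⇒m<n∨m≡n k≤
  ... | inj₁ k<l = Cov-suc l (Cov-≤ (s≤s⁻¹ k<l) c)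
  ... | inj₂ refl = c

  Cov-∪ : ∀ i {j X Y} → Cov i X → Cov j Y → Cov (i + j) (X ∪ Y)
  Cov-∪ zero {j} {X} {Y} empty c = Cov-⊆ j (∪-⊆ (λ x∈ → contradiction x∈ (empty _)) id) c
  Cov-∪ (suc i) {j} {X} {Y} (F , face , c) d = F , face , Cov-⊆ (i + j) sub (Cov-∪ i c d)
    where
    sub : (X ∪ Y) ─ F ⊆ (X ─ F) ∪ Y
    sub {x} x∈ with x∈p∪q⁻ X Y (p─q⊆p _ F x∈)
    ... | inj₁ x∈X = p⊆p∪q Y (x∈p∧x∉q⇒x∈p─q x∈X (x∈p─q⇒x∉q (X ∪ Y) F x∈))
    ... | inj₂ x∈Y = q⊆p∪q (X ─ F) Y x∈Y

  Cov-insert : ∀ {k U} x → Cov k (U - x) → Cov (suc k) U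
  Cov-insert x c = ⁅ x ⁆ , Face-⁅⁆ x , c

  Cov-of-faces : ∀ k {U} (F : Fin k → Subset n) → (∀ c → Face (F c)) →
    (∀ x → x ∈ U → ∃ λ c → x ∈ F c) → Cov k U
  Cov-of-faces zero F face cover x x∈ with () ← proj₁ (cover x x∈)
  Cov-of-faces (suc k) {U} F face cover = F zero , face zero , Cov-of-faces k (F ∘ suc) (face ∘ suc) cover'
    where
    cover' : ∀ x → x ∈ U ─ F zero → ∃ λ c → x ∈ F (suc c)
    cover' x x∈ with cover x (p─q⊆p U (F zero) x∈)
    ... | zero , x∈₀ = contradiction x∈₀ (x∈p─q⇒x∉q U (F zero) x∈)
    ... | suc c , x∈c = c , x∈c

  faces-of-Cov : ∀ k {U} → Cov k U →
    ∃ λ (F : Fin k → Subset n) → (∀ c → Face (F c)) × (∀ x → x ∈ U → ∃ λ c → x ∈ F c)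
  faces-of-Cov zero empty = (λ ()) , (λ ()) , λ x x∈ → contradiction x∈ (empty x)
  faces-of-Cov (suc k) (F₀ , face₀ , c) with F , face , cover ← faces-of-Cov k c =
    (λ { zero → F₀ ; (suc i) → F i }) , (λ { zero → face₀ ; (suc i) → face i }) , cover'
    where
    cover' : ∀ x → x ∈ _ → ∃ _
    cover' x x∈ with x ∈? F₀
    ... | yes x∈₀ = zero , x∈₀
    ... | no x∉ with i , x∈i ← cover x (x∈p∧x∉q⇒x∈p─q x∈ x∉) = suc i , x∈i

  -- Separated sets, criticality and connectedness.

  Sep : Subset n → Subset n → Set
  Sep X Y = ∀ x → x ∈ X → ∀ y → y ∈ Y → ¬ Adj x y

  Sep? : ∀ X Y → Dec (Sep X Y)
  Sep? X Y = all? λ x → (x ∈? X) →-dec all? λ y → (y ∈? Y) →-dec ¬? (Adj? x y)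

  Sep-⊆ : ∀ {X X' Y Y'} → X' ⊆ X → Y' ⊆ Y → Sep X Y → Sep X' Y'
  Sep-⊆ X⊆ Y⊆ sep x x∈ y y∈ = sep x (X⊆ x∈) y (Y⊆ y∈)

  -- A face meeting both sides would contain an edge between them, so each face serves one side: `X`
  -- if it meets `X`, otherwise `Y`.
  Cov-split : ∀ k {X Y} → Sep X Y → Cov k (X ∪ Y) → ∃ λ i → ∃ λ j → i + j ≡ k × Cov i X × Cov j Y
  Cov-split zero {X} {Y} sep empty =
    0 , 0 , refl , (λ x → empty x ∘ p⊆p∪q Y) , (λ x → empty x ∘ q⊆p∪q X Y)
  Cov-split (suc k) {X} {Y} sep (F , face , c) with any? (λ x → (x ∈? X) ×-dec (x ∈? F))
  ... | yes (x , x∈X , x∈F)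
    with i , j , e , a , b ← Cov-split k (Sep-⊆ (p─q⊆p X F) id sep)
           (Cov-⊆ k (∪-⊆ {X ─ F} {Y} (─-monoˡ (p⊆p∪q Y)) λ {y} y∈ →
             x∈p∧x∉q⇒x∈p─q (q⊆p∪q X Y y∈) λ y∈F → sep x x∈X y y∈ (Face⇒Adj face x∈F y∈F)) c)
    = suc i , j , cong suc e , (F , face , a) , b
  Cov-split (suc k) {X} {Y} sep (F , face , c) | no disjoint
    with i , j , e , a , b ← Cov-split k (Sep-⊆ id (p─q⊆p Y F) sep)
           (Cov-⊆ k (∪-⊆ {X} {Y ─ F} (λ x∈ → x∈p∧x∉q⇒x∈p─q (p⊆p∪q Y x∈) λ x∈F → disjoint (_ , x∈ , x∈F))
             (─-monoˡ (q⊆p∪q X Y))) c)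
    = i , suc j , trans (+-suc i j) (cong suc e) , a , (F , face , b)

  χ : ∀ U → ∃ λ k → Cov k U × (∀ j → Cov j U → k ≤ j)
  χ U = least (λ k → Cov? k U) (proj₁ cover) (proj₂ cover)
    where
    covered : ∀ U → Acc _<_ ∣ U ∣ → ∃ λ k → Cov k U
    covered U (acc rec) with nonempty? U
    ... | no empty = 0 , λ x x∈ → empty (x , x∈)
    ... | yes (x , x∈) with covered (U - x) (rec (x∈p⇒∣p-x∣<∣p∣ x∈))
    ...   | k , c = suc k , Cov-insert x c
    cover = covered U (<-wellFounded ∣ U ∣)

  -- This is the drop of the covering number under every vertex deletion, phrased through covers
  -- alone.
  Crit : Subset n → Set
  Crit U = ∀ v → v ∈ U → ∀ i → Cov (suc i) U → Cov i (U - v)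

  Conn : Subset n → Set
  Conn U = ∀ X → X ⊆ U → Nonempty X → Sep X (U ─ X) → U ⊆ X

  Conn⊎split : ∀ U → Conn U ⊎ ∃ λ X → X ⊆ U × Nonempty X × Nonempty (U ─ X) × Sep X (U ─ X)
  Conn⊎split U
    with anySubset? (λ X → (X ⊆? U) ×-dec (nonempty? X ×-dec (nonempty? (U ─ X) ×-dec Sep? X (U ─ X))))
  ... | yes split = inj₂ split
  ... | no ¬split = inj₁ λ X X⊆U ne sep {x} x∈U → decidable-stable (x ∈? X)
    λ x∉X → ¬split (X , X⊆U , ne , (x , x∈p∧x∉q⇒x∈p─q x∈U x∉X) , sep)

  -- An optimal cover of `Y` completes a cover of `X` to one of `U`. Criticality of `U` saves a face
  -- on `U - v`, and after splitting, `Y` still takes at least `w` faces, so the saving falls on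
  -- `X - v`.
  Crit-part : ∀ {U X Y} → X ⊆ U → Y ⊆ U → U ⊆ X ∪ Y → Sep X Y → Crit U → Crit X
  Crit-part {U} {X} {Y} X⊆ Y⊆ U⊆ sep crit v v∈ i c = shrink (χ Y)
    where
    sub : (X - v) ∪ Y ⊆ U - v
    -- `Adj` is reflexive, so `Sep` also forces disjointness and `v` is not in `Y`.
    sub = ∪-⊆ (─-monoˡ X⊆) λ {y} y∈ → x∈p∧x≢y⇒x∈p-y (Y⊆ y∈) λ { refl → sep v v∈ y y∈ (Adj-refl v) }
    shrink : (∃ λ w → Cov w Y × (∀ j → Cov j Y → w ≤ j)) → Cov i (X - v)
    shrink (w , cY , min)
      with i' , w' , e , cX , cY' ← Cov-split (i + w) (Sep-⊆ (p─q⊆p X ⁅ v ⁆) id sep)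
             (Cov-⊆ (i + w) sub (crit v (X⊆ v∈) (i + w) (Cov-⊆ (suc i + w) U⊆ (Cov-∪ (suc i) c cY))))
      = Cov-≤ (+-cancelʳ-≤ w i' i (≤-trans (+-monoʳ-≤ i' (min w' cY')) (≤-reflexive e))) cX

  -- The resulting `U` has covering number exactly `d + 1`, since putting `v` back costs one face.
  minimal-uncovered : ∀ d W → Acc _<_ ∣ W ∣ → ¬ Cov d W →
    ∃ λ U → U ⊆ W × ¬ Cov d U × (∀ v → v ∈ U → Cov d (U - v))
  minimal-uncovered d W (acc rec) ¬c with any? (λ v → (v ∈? W) ×-dec ¬? (Cov? d (W - v)))
  ... | no none = W , id , ¬c , λ v v∈ → decidable-stable (Cov? d (W - v)) λ ¬c' → none (v , v∈ , ¬c')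
  ... | yes (v , v∈ , ¬c') with minimal-uncovered d (W - v) (rec (x∈p⇒∣p-x∣<∣p∣ v∈)) ¬c'
  ...   | U , U⊆ , rest = U , p─q⊆p W ⁅ v ⁆ ∘ U⊆ , rest

  -- Decomposition of a critical set into connected components.

  record Components (U : Subset n) : Set where
    field
      q : ℕ
      P : Fin q → Subset n
      P-⊆ : ∀ b → P b ⊆ U
      P-cover : ∀ x → x ∈ U → ∃ λ b → x ∈ P b
      P-sep : ∀ b c x y → x ∈ P b → y ∈ P c → Adj x y → b ≡ c
      P-nonempty : ∀ b → Nonempty (P b)
      P-crit : ∀ b → Crit (P b)
      size : ℕ
      cov : Cov size U
      size≤ : 2 * size ≤ ∣ U ∣ + q

  -- Amounts to `2 χ(U) ≤ |U| + 1`, with any sufficiently small cover in place of an optimal one.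
  Bound : Subset n → Set
  Bound U = ∃ λ k → Cov k U × 2 * k ≤ suc ∣ U ∣

  2*-sum≤ : ∀ {a b x y p q u} → 2 * a ≤ x + p → 2 * b ≤ y + q → x + y ≤ u → 2 * (a + b) ≤ u + (p + q)
  2*-sum≤ {a} {b} {x} {y} {p} {q} {u} l m e = begin
    2 * (a + b)          ≡⟨ *-distribˡ-+ 2 a b ⟩
    2 * a + 2 * b        ≤⟨ +-mono-≤ l m ⟩
    (x + p) + (y + q)    ≡⟨ interchange x p y q ⟩
    (x + y) + (p + q)    ≤⟨ +-monoˡ-≤ (p + q) e ⟩
    u + (p + q)          ∎
    where
    open ≤-Reasoning

  ∪-components : ∀ {U X Y} → X ⊆ U → Y ⊆ U → U ⊆ X ∪ Y → ∣ X ∣ + ∣ Y ∣ ≤ ∣ U ∣ → Sep X Y →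
    Components X → Components Y → Components U
  ∪-components {U} {X} {Y} X⊆U Y⊆U U⊆ size sep cX cY = record
    { q = A.q + B.q
    ; P = λ b → part (splitAt A.q b)
    ; P-⊆ = λ b → part-⊆ (splitAt A.q b)
    ; P-cover = cover
    ; P-sep = psep
    ; P-nonempty = λ b → [_,_] {C = λ s → Nonempty (part s)} A.P-nonempty B.P-nonempty (splitAt A.q b)
    ; P-crit = λ b → [_,_] {C = λ s → Crit (part s)} A.P-crit B.P-crit (splitAt A.q b)
    ; size = A.size + B.size
    ; cov = Cov-⊆ (A.size + B.size) U⊆ (Cov-∪ A.size A.cov B.cov)
    ; size≤ = 2*-sum≤ {A.size} {B.size} {∣ X ∣} {∣ Y ∣} {A.q} {B.q} A.size≤ B.size≤ size }
    where
    module A = Components cX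
    module B = Components cY
    part : Fin A.q ⊎ Fin B.q → Subset n
    part = [ A.P , B.P ]′
    part-⊆ : ∀ s → part s ⊆ U
    part-⊆ (inj₁ i) = X⊆U ∘ A.P-⊆ i
    part-⊆ (inj₂ j) = Y⊆U ∘ B.P-⊆ j
    cover : ∀ x → x ∈ U → ∃ λ b → x ∈ part (splitAt A.q b)
    cover x x∈ with x∈p∪q⁻ X Y (U⊆ x∈)
    ... | inj₁ x∈X with i , x∈i ← A.P-cover x x∈X =
      i ↑ˡ B.q , subst (λ s → x ∈ part s) (sym (splitAt-↑ˡ A.q i B.q)) x∈i
    ... | inj₂ x∈Y with j , x∈j ← B.P-cover x x∈Y =
      A.q ↑ʳ j , subst (λ s → x ∈ part s) (sym (splitAt-↑ʳ A.q B.q j)) x∈j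
    psep : ∀ b c x y → x ∈ part (splitAt A.q b) → y ∈ part (splitAt A.q c) → Adj x y → b ≡ c
    psep b c x y x∈ y∈ a with splitAt A.q b in eb | splitAt A.q c in ec
    ... | inj₁ i | inj₁ i' =
      trans (sym (splitAt⁻¹-↑ˡ eb)) (trans (cong (_↑ˡ B.q) (A.P-sep i i' x y x∈ y∈ a)) (splitAt⁻¹-↑ˡ ec))
    ... | inj₁ i | inj₂ j = contradiction a (sep x (A.P-⊆ i x∈) y (B.P-⊆ j y∈))
    ... | inj₂ j | inj₁ i = contradiction (Adj-sym a) (sep y (A.P-⊆ i y∈) x (B.P-⊆ j x∈))
    ... | inj₂ j | inj₂ j' =
      trans (sym (splitAt⁻¹-↑ʳ eb)) (trans (cong (A.q ↑ʳ_) (B.P-sep j j' x y x∈ y∈ a)) (splitAt⁻¹-↑ʳ ec))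

  -- A critical set either is connected, where `bound` applies, or splits into two separated parts,
  -- which are smaller and again critical.
  components : ∀ U → Acc _<_ ∣ U ∣ → Nonempty U → Crit U →
    (∀ W → W ⊆ U → Conn W → Crit W → Bound W) → Components U
  components U (acc rec) ne crit bound with Conn⊎split U
  ... | inj₁ conn with k , c , k≤ ← bound U id conn crit = record
    { q = 1 ; P = λ _ → U ; P-⊆ = λ _ → id ; P-cover = λ _ x∈ → zero , x∈
    ; P-sep = λ { zero zero _ _ _ _ _ → refl } ; P-nonempty = λ _ → ne ; P-crit = λ _ → crit
    ; size = k ; cov = c ; size≤ = ≤-trans k≤ (≤-reflexive (+-comm 1 ∣ U ∣)) }
  ... | inj₂ (X , X⊆U , (x₀ , x₀∈) , (y₀ , y₀∈) , sep) =
    ∪-components X⊆U Y⊆U U⊆ (∣q∣+∣p─q∣≤∣p∣ U X X⊆U) sep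
      (components X (rec (p⊂q⇒∣p∣<∣q∣ (X⊆U , y₀ , Y⊆U y₀∈ , x∈p─q⇒x∉q U X y₀∈))) (x₀ , x₀∈)
        (Crit-part X⊆U Y⊆U U⊆ sep crit) (λ W W⊆ → bound W (X⊆U ∘ W⊆)))
      (components Y (rec (p∩q≢∅⇒∣p─q∣<∣p∣ U X (x₀ , x∈p∩q⁺ (X⊆U x₀∈ , x₀∈)))) (y₀ , y₀∈)
        (Crit-part Y⊆U X⊆U (∪-⊆ (q⊆p∪q Y X) (p⊆p∪q X) ∘ U⊆)
          (λ y y∈ x x∈ → sep x x∈ y y∈ ∘ Adj-sym) crit) (λ W W⊆ → bound W (Y⊆U ∘ W⊆)))
    where
    Y = U ─ X
    Y⊆U : Y ⊆ U
    Y⊆U = p─q⊆p U X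
    U⊆ : U ⊆ X ∪ Y
    U⊆ {x} x∈ with x ∈? X
    ... | yes x∈X = p⊆p∪q Y x∈X
    ... | no x∉X = q⊆p∪q X Y (x∈p∧x∉q⇒x∈p─q x∈ x∉X)

  -- Extending covers at no cost along a tight matching.

  open Matching

  ⋃ᶠ : ∀ {r} → (Fin r → Subset n) → Subset n
  ⋃ᶠ P = ⋃ (List.tabulate P)

  ∈⋃ᶠ⁺ : ∀ {r} (P : Fin r → Subset n) {x} b → x ∈ P b → x ∈ ⋃ᶠ P
  ∈⋃ᶠ⁺ P zero x∈ = p⊆p∪q _ x∈
  ∈⋃ᶠ⁺ P (suc b) x∈ = q⊆p∪q (P zero) _ (∈⋃ᶠ⁺ (P ∘ suc) b x∈)

  ∈⋃ᶠ⁻ : ∀ {r} (P : Fin r → Subset n) {x} → x ∈ ⋃ᶠ P → ∃ λ b → x ∈ P b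
  ∈⋃ᶠ⁻ {zero} P x∈ = contradiction x∈ ∉⊥
  ∈⋃ᶠ⁻ {suc r} P x∈ with x∈p∪q⁻ (P zero) _ x∈
  ... | inj₁ x∈₀ = zero , x∈₀
  ... | inj₂ x∈₁ with b , x∈b ← ∈⋃ᶠ⁻ (P ∘ suc) x∈₁ = suc b , x∈b

  -- The sets `P b` are separated from each other and from `Z`, so the cover splits into covers of
  -- the pieces. Each piece absorbs `T b` without a further face, and the covers are put together
  -- again.
  Cov-exchange : ∀ {r} (P T : Fin r → Subset n) {Z} k → (∀ b i → Cov i (P b) → Cov i (P b ∪ T b)) →
    (∀ b c x y → x ∈ P b → y ∈ P c → Adj x y → b ≡ c) → (∀ b → Sep (P b) Z) →
    Cov k (Z ∪ ⋃ᶠ P) → Cov k (Z ∪ ⋃ᶠ (λ b → P b ∪ T b))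
  Cov-exchange {zero} P T k absorb P-sep sep c = c
  Cov-exchange {suc r} P T {Z} k absorb P-sep sep c = recombine (Cov-split k sep₀ (Cov-⊆ k swap⁻ c))
    where
    P' = ⋃ᶠ (P ∘ suc)
    P∪T = P zero ∪ T zero
    rest = ⋃ᶠ (λ b → P (suc b) ∪ T (suc b))
    sep₀ : Sep (P zero) (Z ∪ P')
    sep₀ x x∈ y y∈ a with x∈p∪q⁻ Z P' y∈
    ... | inj₁ y∈Z = sep zero x x∈ y y∈Z a
    ... | inj₂ y∈P' with b , y∈b ← ∈⋃ᶠ⁻ (P ∘ suc) y∈P' with () ← P-sep zero (suc b) x y x∈ y∈b a
    swap⁻ : P zero ∪ (Z ∪ P') ⊆ Z ∪ (P zero ∪ P')
    swap⁻ = ∪-⊆ (q⊆p∪q Z _ ∘ p⊆p∪q P') (∪-⊆ (p⊆p∪q _) (q⊆p∪q Z _ ∘ q⊆p∪q (P zero) P'))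
    swap⁺ : Z ∪ (P∪T ∪ rest) ⊆ P∪T ∪ (Z ∪ rest)
    swap⁺ = ∪-⊆ (q⊆p∪q P∪T _ ∘ p⊆p∪q rest) (∪-⊆ (p⊆p∪q _) (q⊆p∪q P∪T _ ∘ q⊆p∪q Z rest))
    recombine : (∃ λ i → ∃ λ j → i + j ≡ k × Cov i (P zero) × Cov j (Z ∪ P')) → Cov k (Z ∪ (P∪T ∪ rest))
    recombine (i , j , refl , c₀ , c₁) = Cov-⊆ (i + j) swap⁺ (Cov-∪ i (absorb zero i c₀)
      (Cov-exchange (P ∘ suc) (T ∘ suc) j (absorb ∘ suc)
        (λ b c x y x∈ y∈ a → suc-injective (P-sep (suc b) (suc c) x y x∈ y∈ a)) (sep ∘ suc) c₁))

  Touches : ∀ {U} (C : Components U) → Fin n → Fin (Components.q C) → Set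
  Touches C a b = ∃ λ p → p ∈ Components.P C b × Adj a p

  -- Criticality covers `X - p` with one face fewer, and the edge joining `a` to `p` is the face
  -- saved.
  Cov-absorb : ∀ {X a p} → Crit X → p ∈ X → Adj a p → ∀ i → Cov i X → Cov i (X ∪ ⁅ a ⁆)
  Cov-absorb crit p∈ adj zero empty = contradiction p∈ (empty _)
  Cov-absorb {X} {a} {p} crit p∈ adj (suc i) c = ⁅ a ⁆ ∪ ⁅ p ⁆ , adj , Cov-⊆ i sub (crit p p∈ i c)
    where
    sub : (X ∪ ⁅ a ⁆) ─ (⁅ a ⁆ ∪ ⁅ p ⁆) ⊆ X - p
    sub {x} x∈ with x∈p∪q⁻ X ⁅ a ⁆ (p─q⊆p _ (⁅ a ⁆ ∪ ⁅ p ⁆) x∈)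
    ... | inj₁ x∈X = x∈p∧x∉q⇒x∈p─q x∈X (x∈p─q⇒x∉q _ (⁅ a ⁆ ∪ ⁅ p ⁆) x∈ ∘ q⊆p∪q ⁅ a ⁆ ⁅ p ⁆)
    ... | inj₂ x∈a = contradiction (p⊆p∪q ⁅ p ⁆ x∈a) (x∈p─q⇒x∉q _ (⁅ a ⁆ ∪ ⁅ p ⁆) x∈)

  module _ {V U : Subset n} (V-crit : Crit V) (U⊆V : U ⊆ V) (C : Components U)
    (tight : TightMatching (Touches C) (V ─ U)) where
    open Components C
    open TightMatching tight
    open IsMatching matching

    private
      -- Both families are made total on `Fin q` by empty sets, `P'` off `Q` and `T` off the
      -- partners of `S`, to fit `Cov-exchange`.
      P' T : Fin q → Subset n
      P' b with b ∈? Q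
      ... | yes _ = P b
      ... | no _ = ⊥
      T b with any? (λ a → (a ∈? S) ×-dec (m a ≟ b))
      ... | yes (a , _) = ⁅ a ⁆
      ... | no _ = ⊥

      ∈P'⁺ : ∀ {x b} → b ∈ Q → x ∈ P b → x ∈ P' b
      ∈P'⁺ {x} {b} b∈ x∈ with b ∈? Q
      ... | yes _ = x∈
      ... | no b∉ = contradiction b∈ b∉

      ∈P'⁻ : ∀ {x} b → x ∈ P' b → b ∈ Q × x ∈ P b
      ∈P'⁻ b x∈ with b ∈? Q
      ... | yes b∈ = b∈ , x∈
      ... | no _ = contradiction x∈ ∉⊥

      ∈T : ∀ {a} → a ∈ S → a ∈ T (m a)
      ∈T {a} a∈ with any? (λ a' → (a' ∈? S) ×-dec (m a' ≟ m a))
      ... | yes (a' , a'∈ , eq) rewrite inj a'∈ a∈ eq = x∈⁅x⁆ a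
      ... | no none = contradiction (a , a∈ , refl) none

      absorb : ∀ b i → Cov i (P' b) → Cov i (P' b ∪ T b)
      absorb b i c with any? (λ a → (a ∈? S) ×-dec (m a ≟ b))
      absorb b i c | no _ = Cov-⊆ i (∪-⊆ id (λ x∈ → contradiction x∈ ∉⊥)) c
      -- Here `b` is `m a`, which lies in `Q`, so `P' b` is a critical component touched by `a`.
      absorb b i c | yes (a , a∈ , refl) with m a ∈? Q | edge a∈
      ... | no m∉ | _ = contradiction (m∈Q a∈) m∉
      ... | yes _ | p , p∈ , adj = Cov-absorb (P-crit (m a)) p∈ adj i c

      Z : Subset n
      Z = V ─ S ─ ⋃ᶠ P'

      Z⁻ : ∀ {x} → x ∈ Z → x ∈ V × x ∉ S × x ∉ ⋃ᶠ P'
      Z⁻ x∈ = p─q⊆p V S x∈' , x∈p─q⇒x∉q V S x∈' , x∈p─q⇒x∉q (V ─ S) (⋃ᶠ P') x∈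
        where x∈' = p─q⊆p (V ─ S) (⋃ᶠ P') x∈

      -- A neighbour of a component in `Q` lies in that component if it is in `U`, and in `S` by
      -- `closed` if it is in `V ─ U`; `Z` avoids both.
      Z-sep : ∀ b → Sep (P' b) Z
      Z-sep b x x∈ z z∈ adj with ∈P'⁻ b x∈ | Z⁻ z∈ | z ∈? U
      ... | b∈ , x∈b | z∈V , z∉S , z∉P' | yes z∈U with c , z∈c ← P-cover z z∈U
                                            with refl ← P-sep b c x z x∈b z∈c adj =
        z∉P' (∈⋃ᶠ⁺ P' b (∈P'⁺ b∈ z∈c))
      ... | b∈ , x∈b | z∈V , z∉S , z∉P' | no z∉U =
        z∉S (closed (x∈p∧x∉q⇒x∈p─q z∈V z∉U) b∈ (x , x∈b , Adj-sym adj))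

    -- Deleting a single `a` in `S` saves a face. The cover of `V - a` contains `Z` and the
    -- components in `Q`, and the exchange then restores all of `S` for free.
    tight⇒Cov : ∀ k → Cov (suc k) V → Cov k V
    tight⇒Cov k c with a , a∈ ← nonempty =
      Cov-⊆ k V⊆ (Cov-exchange P' T k absorb
        (λ b c x y x∈ y∈ → P-sep b c x y (proj₂ (∈P'⁻ b x∈)) (proj₂ (∈P'⁻ c y∈))) Z-sep
        (Cov-⊆ k (∪-⊆ Z⊆ P'⊆) (V-crit a (p─q⊆p V U (S⊆A a∈)) k c)))
      where
      Z⊆ : Z ⊆ V - a
      Z⊆ x∈ with x∈V , x∉S , _ ← Z⁻ x∈ = x∈p∧x≢y⇒x∈p-y x∈V λ { refl → x∉S a∈ }
      P'⊆ : ⋃ᶠ P' ⊆ V - a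
      P'⊆ x∈ with b , x∈b ← ∈⋃ᶠ⁻ P' x∈ with x∈U ← P-⊆ b (proj₂ (∈P'⁻ b x∈b)) =
        x∈p∧x≢y⇒x∈p-y (U⊆V x∈U) λ { refl → x∈p─q⇒x∉q V U (S⊆A a∈) x∈U }
      V⊆ : V ⊆ Z ∪ ⋃ᶠ (λ b → P' b ∪ T b)
      V⊆ {x} x∈ with x ∈? S | x ∈? ⋃ᶠ P'
      ... | yes x∈S | _ = q⊆p∪q Z _ (∈⋃ᶠ⁺ _ (m x) (q⊆p∪q (P' (m x)) _ (∈T x∈S)))
      ... | no x∉S | no x∉P' = p⊆p∪q _ (x∈p∧x∉q⇒x∈p─q (x∈p∧x∉q⇒x∈p─q x∈ x∉S) x∉P')
      ... | no x∉S | yes x∈P' with b , x∈b ← ∈⋃ᶠ⁻ P' x∈P' =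
        q⊆p∪q Z _ (∈⋃ᶠ⁺ _ b (p⊆p∪q (T b) x∈b))

  -- The bound for connected critical sets.

  outer-neighbour : ∀ {V U a} → Conn V → a ∈ V ─ U → U ⊆ V → (C : Components U) → ∀ b →
    ¬ ¬ (∃ λ a → a ∈ V ─ U × Touches C a b)
  outer-neighbour {V} {U} {a} conn a∈ U⊆V C b none =
    -- Without a neighbour outside `U`, `P b` would be separated from the rest of `V`, and
    -- connectedness would put `a` into it.
    x∈p─q⇒x∉q V U a∈ (P-⊆ b (conn (P b) (U⊆V ∘ P-⊆ b) (P-nonempty b) sep (p─q⊆p V U a∈)))
    where
    open Components C
    sep : Sep (P b) (V ─ P b)
    sep x x∈ y y∈ adj with y ∈? U
    ... | no y∉ = none (y , x∈p∧x∉q⇒x∈p─q (p─q⊆p V (P b) y∈) y∉ , x , x∈ , Adj-sym adj)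
    ... | yes y∈U with c , y∈c ← P-cover y y∈U with refl ← P-sep b c x y x∈ y∈c adj =
      x∈p─q⇒x∉q V (P b) y∈ y∈c

  conn-crit-bound : ∀ V → Acc _<_ ∣ V ∣ → Conn V → Crit V → Bound V
  conn-crit-bound V (acc rec) conn crit with nonempty? V | χ V
  ... | no empty | _ = 0 , (λ x x∈ → empty (x , x∈)) , z≤n
  ... | yes (a , a∈) | zero , c , _ = contradiction a∈ (c a)
  ... | yes (a , a∈) | suc zero , c , _ = 1 , c , s≤s (≤-<-trans z≤n (x∈p⇒∣p-x∣<∣p∣ a∈))
  ... | yes (a , a∈) | suc (suc d) , c , min
    with U , U⊆V-a , ¬cU , cU- ← minimal-uncovered d (V - a) (<-wellFounded _)
           (λ c' → <⇒≱ (n<1+n (suc d)) (min (suc d) (Cov-insert a c'))) =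
    -- The inequality is decidable, so its failure may be assumed and the double-negated tight
    -- matching used.
    suc (suc d) , c , decidable-stable (2 * suc (suc d) ≤? suc ∣ V ∣) λ large →
      tight-matching (Touches components-U) (A≤q large) (a , a∈A)
        (outer-neighbour conn a∈A U⊆V components-U)
        λ tight → <⇒≱ (n<1+n (suc d)) (min (suc d) (tight⇒Cov crit U⊆V components-U tight (suc d) c))
    where
    U⊆V : U ⊆ V
    U⊆V = p─q⊆p V ⁅ a ⁆ ∘ U⊆V-a
    a∈A : a ∈ V ─ U
    a∈A = x∈p∧x∉q⇒x∈p─q a∈ λ a∈U → x∈p─q⇒x∉q V ⁅ a ⁆ (U⊆V-a a∈U) (x∈⁅x⁆ a)
    U<V : ∣ U ∣ < ∣ V ∣
    U<V = p⊂q⇒∣p∣<∣q∣ (U⊆V , a , a∈ , x∈p─q⇒x∉q V U a∈A)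
    U-nonempty : Nonempty U
    U-nonempty = decidable-stable (nonempty? U) λ empty → ¬cU (Cov-≤ {0} {d} z≤n λ x x∈ → empty (x , x∈))
    -- `U` has no cover by `d` faces, so `suc i` exceeds `d`, and `d` faces suffice for `U - v`.
    U-crit : Crit U
    U-crit v v∈ i c' with suc i ≤? d
    ... | yes i<d = contradiction (Cov-≤ i<d c') ¬cU
    ... | no i≮d = Cov-≤ (s≤s⁻¹ (≰⇒> i≮d)) (cU- v v∈)
    components-U : Components U
    components-U = components U (<-wellFounded _) U-nonempty U-crit λ W W⊆U →
      conn-crit-bound W (rec (≤-<-trans (p⊆q⇒∣p∣≤∣q∣ W⊆U) U<V))
    open Components components-U
    d<size : d < size
    d<size = ≰⇒> λ size≤d → ¬cU (Cov-≤ size≤d cov)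
    -- Failure of the bound means `|V| ≤ 2 (d + 1)`, and `d + 1` is at most `size`.
    A≤q : ¬ (2 * suc (suc d) ≤ suc ∣ V ∣) → ∣ V ─ U ∣ ≤ q
    A≤q large = +-cancelˡ-≤ ∣ U ∣ _ _ (begin
      ∣ U ∣ + ∣ V ─ U ∣   ≤⟨ ∣q∣+∣p─q∣≤∣p∣ V U U⊆V ⟩
      ∣ V ∣               ≤⟨ s≤s⁻¹ (s≤s⁻¹ (≤-trans (≰⇒> large) (≤-reflexive (*-suc 2 (suc d))))) ⟩
      2 * suc d           ≤⟨ *-monoʳ-≤ 2 d<size ⟩
      2 * size            ≤⟨ size≤ ⟩
      ∣ U ∣ + q           ∎)
      where open ≤-Reasoning

-- Boolean predicates as subsets, finite sums and induced subgraphs.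

∈-tabulate⁺ : ∀ {n} {f : Fin n → Bool} {x} → f x ≡ true → x ∈ tabulate f
∈-tabulate⁺ {f = f} {x} e = lookup⇒[]= x _ (trans (lookup∘tabulate f x) e)

∈-tabulate⁻ : ∀ {n} {f : Fin n → Bool} {x} → x ∈ tabulate f → f x ≡ true
∈-tabulate⁻ {f = f} {x} x∈ = trans (sym (lookup∘tabulate f x)) ([]=⇒lookup x∈)

sumF-mono : ∀ {n} {f g : Fin n → ℕ} → (∀ i → f i ≤ g i) → sumF f ≤ sumF g
sumF-mono {zero} f≤g = z≤n
sumF-mono {suc n} f≤g = +-mono-≤ (f≤g zero) (sumF-mono (f≤g ∘ suc))

sumF-zero : ∀ {n} {f : Fin n → ℕ} → (∀ i → f i ≡ 0) → sumF f ≡ 0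
sumF-zero {zero} f≡0 = refl
sumF-zero {suc n} f≡0 = cong₂ _+_ (f≡0 zero) (sumF-zero (f≡0 ∘ suc))

sumF-single : ∀ {n} {f : Fin n → ℕ} i → (∀ j → j ≢ i → f j ≡ 0) → sumF f ≡ f i
sumF-single {suc n} {f} zero f≡0 = trans (cong (f zero +_) (sumF-zero λ j → f≡0 (suc j) λ ())) (+-identityʳ _)
sumF-single {suc n} (suc i) f≡0 rewrite f≡0 zero (λ ()) = sumF-single i λ j j≢i → f≡0 (suc j) (j≢i ∘ suc-injective)

sumF-indicator : ∀ {n} (f : Fin n → Bool) → sumF (λ v → if f v then 1 else 0) ≡ ∣ tabulate f ∣
sumF-indicator {zero} f = refl
sumF-indicator {suc n} f with f zero
... | true = cong suc (sumF-indicator (f ∘ suc))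
... | false = sumF-indicator (f ∘ suc)

∧-true⁻ : ∀ {a b} → a ∧ b ≡ true → a ≡ true × b ≡ true
∧-true⁻ {true} {true} _ = refl , refl

∧-true⁺ : ∀ {a b} → a ≡ true → b ≡ true → a ∧ b ≡ true
∧-true⁺ refl refl = refl

inClass⁺ : ∀ {k} b {g : b ≡ true → Fin k} {c} (p : b ≡ true) → g p ≡ c → inClass b g c ≡ true
inClass⁺ true {g} {c} refl e with g refl ≟ c
... | yes _ = refl
... | no ¬e = contradiction e ¬e

inClass⁻ : ∀ {k} b {g : b ≡ true → Fin k} {c} → inClass b g c ≡ true → ∃ λ p → g p ≡ c
inClass⁻ true {g} {c} i with g refl ≟ c
... | yes e = refl , e

induce-WF : ∀ {n} {G : MGraph n} P → WF G → WF (induce G P)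
induce-WF {G = G} P (μ-sym , μ-irrefl , μ-outside) = symm , irrefl , outside'
  where
  symm : ∀ u v → μ (induce G P) u v ≡ μ (induce G P) v u
  symm u v with P u | P v
  ... | true | true = μ-sym u v
  ... | true | false = refl
  ... | false | true = refl
  ... | false | false = refl
  irrefl : ∀ v → μ (induce G P) v v ≡ 0
  irrefl v with P v
  ... | true = μ-irrefl v
  ... | false = refl
  outside' : ∀ u v → V G u ∧ P u ≡ false → μ (induce G P) u v ≡ 0
  outside' u v e with P u | P v
  ... | false | _ = refl
  ... | true | false = refl
  ... | true | true = μ-outside u v (trans (sym (∧-identityʳ (V G u))) e)

μ-induce≤ : ∀ {n} (G : MGraph n) P u v → μ (induce G P) u v ≤ μ G u v
μ-induce≤ G P u v with P u ∧ P v
... | true = ≤-refl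
... | false = z≤n

-- The complex of vertex sets inducing strictly degenerate subgraphs.

module Graph (t : ℕ) (1≤t : 1 ≤ t) {n : ℕ} (G : MGraph n) (WF-G : WF G) where

  μ-sym : ∀ u v → μ G u v ≡ μ G v u
  μ-sym = proj₁ WF-G

  μ-irrefl : ∀ v → μ G v v ≡ 0
  μ-irrefl = proj₁ (proj₂ WF-G)

  degIn : Subset n → Fin n → ℕ
  degIn T v = sumF (λ u → if lookup T u then μ G u v else 0)

  LowVertex : Subset n → Set
  LowVertex T = ∃ λ v → v ∈ T × degIn T v < t

  -- G[S] is strictly t-degenerate, tested on induced subgraphs only, which makes the property decidable.
  Face : Subset n → Set
  Face S = ¬ ∃ λ T → T ⊆ S × Nonempty T × ¬ LowVertex T

  low? : ∀ T → Dec (LowVertex T)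
  low? T = any? λ v → (v ∈? T) ×-dec (suc (degIn T v) ≤? t)

  Face? : ∀ S → Dec (Face S)
  Face? S = ¬? (anySubset? λ T → (T ⊆? S) ×-dec (nonempty? T ×-dec ¬? (low? T)))

  Face-⊆ : ∀ {S T} → S ⊆ T → Face T → Face S
  Face-⊆ S⊆T face (X , X⊆S , rest) = face (X , S⊆T ∘ X⊆S , rest)

  Face-⊥ : Face ⊥
  Face-⊥ (T , T⊆⊥ , (x , x∈) , _) = ∉⊥ (T⊆⊥ x∈)

  -- Without loops only `y` can contribute to the degree of `x`.
  degIn-pair : ∀ {T} x y → T ⊆ ⁅ x ⁆ ∪ ⁅ y ⁆ → degIn T x ≤ μ G y x
  degIn-pair {T} x y T⊆ = ≤-trans (≤-reflexive (sumF-single y outside-pair)) at-y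
    where
    outside-pair : ∀ u → u ≢ y → (if lookup T u then μ G u x else 0) ≡ 0
    outside-pair u u≢y with lookup T u in eq
    ... | false = refl
    ... | true with x∈p∪q⁻ ⁅ x ⁆ ⁅ y ⁆ (T⊆ (lookup⇒[]= u T eq))
    ...   | inj₁ u∈x rewrite x∈⁅y⁆⇒x≡y x u∈x = μ-irrefl x
    ...   | inj₂ u∈y = contradiction (x∈⁅y⁆⇒x≡y y u∈y) u≢y
    at-y : (if lookup T y then μ G y x else 0) ≤ μ G y x
    at-y with lookup T y
    ... | true = ≤-refl
    ... | false = z≤n

  Face-pair : ∀ x y → μ G x y < t → Face (⁅ x ⁆ ∪ ⁅ y ⁆)
  Face-pair x y small (T , T⊆ , (z , z∈) , ¬low) with x∈p∪q⁻ ⁅ x ⁆ ⁅ y ⁆ (T⊆ z∈)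
  ... | inj₁ z∈x with refl ← x∈⁅y⁆⇒x≡y x z∈x =
    ¬low (x , z∈ , ≤-<-trans (degIn-pair x y T⊆) (subst (_< t) (μ-sym x y) small))
  ... | inj₂ z∈y with refl ← x∈⁅y⁆⇒x≡y y z∈y =
    ¬low (y , z∈ , ≤-<-trans (degIn-pair y x (subst (T ⊆_) (∪-comm ⁅ x ⁆ ⁅ y ⁆) T⊆)) small)

  Face-⁅⁆ : ∀ x → Face ⁅ x ⁆
  -- The pair of `x` with itself has multiplicity 0, which is below `t` because `t` is positive.
  Face-⁅⁆ x = Face-⊆ (p⊆p∪q ⁅ x ⁆) (Face-pair x x (subst (_< t) (sym (μ-irrefl x)) 1≤t))

  -- Colourings of induced subgraphs as covers by faces.

  open Complex Face Face? Face-⊆ Face-⁅⁆ Face-⊥ public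

  -- A predicate rather than the form `induce G P`, so that it applies to `G` itself as well as to
  -- `G` with a vertex deleted.
  record Induced (H : MGraph n) : Set where
    field
      V-⊆ : ∀ v → V H v ≡ true → V G v ≡ true
      μ-≡ : ∀ u v → V H u ≡ true → V H v ≡ true → μ H u v ≡ μ G u v

  open Induced

  induce-Induced : ∀ P → Induced (induce G P)
  induce-Induced P = record { V-⊆ = λ _ → proj₁ ∘ ∧-true⁻ ; μ-≡ = eq }
    where
    eq : ∀ u v → V G u ∧ P u ≡ true → V G v ∧ P v ≡ true → μ (induce G P) u v ≡ μ G u v
    eq u v u∈ v∈ rewrite proj₂ (∧-true⁻ {V G u} u∈) | proj₂ (∧-true⁻ {V G v} v∈) = refl

  module _ {H : MGraph n} (ind : Induced H) where

    class : (Fin n → Bool) → Subset n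
    class C = tabulate (λ v → V H v ∧ C v)

    class⁻ : ∀ {C v} → v ∈ class C → V H v ≡ true × C v ≡ true
    class⁻ v∈ = ∧-true⁻ (∈-tabulate⁻ v∈)

    -- Each test set `T` yields the subgraph `K` of `G` induced on it. This lies in `induce H C`
    -- because `H` is induced, and `degIn T` is at most the degree in `K`.
    degenerate⇒Face : ∀ C → StrictlyDegenerate t (induce H C) → Face (class C)
    degenerate⇒Face C degenerate (T , T⊆ , (x , x∈) , ¬low) = ¬low (low (degenerate K
      (induce-WF (lookup T) WF-G) (V⊆ , μ≤) (x , ∧-true⁺ (V-⊆ ind x (proj₁ (class⁻ (T⊆ x∈)))) ([]=⇒lookup x∈))))
      where
      K : MGraph n
      K = induce G (lookup T)
      V⊆ : ∀ v → V K v ≡ true → V (induce H C) v ≡ true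
      V⊆ v e = ∈-tabulate⁻ (T⊆ (lookup⇒[]= v T (proj₂ (∧-true⁻ {V G v} e))))
      μ≤ : ∀ u v → μ K u v ≤ μ (induce H C) u v
      μ≤ u v with lookup T u in eu | lookup T v in ev
      ... | false | _ = z≤n
      ... | true | false = z≤n
      ... | true | true
        with Hu , Cu ← class⁻ {C} (T⊆ (lookup⇒[]= u T eu))
        with Hv , Cv ← class⁻ {C} (T⊆ (lookup⇒[]= v T ev))
        rewrite Cu | Cv = ≤-reflexive (sym (μ-≡ ind u v Hu Hv))
      deg≤ : ∀ v → lookup T v ≡ true → ∀ u → (if lookup T u then μ G u v else 0) ≤ μ K u v
      deg≤ v e u rewrite e with lookup T u
      ... | true = ≤-refl
      ... | false = z≤n

      low : (∃ λ v → V K v ≡ true × suc (deg K v) ≤ t) → LowVertex T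
      low (v , v∈ , small) = v , lookup⇒[]= v T v∈T , ≤-<-trans (sumF-mono (deg≤ v v∈T)) small
        where v∈T = proj₂ (∧-true⁻ {V G v} v∈)

    -- On a given vertex set degrees are largest in the induced subgraph, so a low vertex of the set
    -- `V K` is low in `K`.
    Face⇒degenerate : ∀ C → Face (class C) → StrictlyDegenerate t (induce H C)
    Face⇒degenerate C face K (_ , _ , K-off) (V⊆ , μ≤) (x , x∈)
      with v , v∈ , small ← decidable-stable (low? (tabulate (V K))) (λ ¬low →
             face (tabulate (V K) , (λ {v} v∈ → ∈-tabulate⁺ (V⊆ v (∈-tabulate⁻ v∈))) , (x , ∈-tabulate⁺ x∈) , ¬low))
      = v , ∈-tabulate⁻ v∈ , ≤-<-trans (sumF-mono (le (∈-tabulate⁻ v∈))) small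
      where
      le : ∀ {v} → V K v ≡ true → ∀ u → μ K u v ≤ (if lookup (tabulate (V K)) u then μ G u v else 0)
      le {v} Kv u rewrite lookup∘tabulate (V K) u with V K u in Ku
      ... | false = ≤-reflexive (K-off u v Ku)
      ... | true = ≤-trans (μ≤ u v) (≤-trans (μ-induce≤ H C u v)
        (≤-reflexive (μ-≡ ind u v (proj₁ (∧-true⁻ (V⊆ u Ku))) (proj₁ (∧-true⁻ (V⊆ v Kv))))))

    Colourable⇒Cov : ∀ k → Colourable t H k → Cov k (tabulate (V H))
    Colourable⇒Cov k (f , degenerate) =
      Cov-of-faces k (λ c → class (λ v → inClass (V H v) (f v) c)) (λ c → degenerate⇒Face _ (degenerate c))
        λ x x∈ → f x (∈-tabulate⁻ x∈) ,
          ∈-tabulate⁺ (∧-true⁺ (∈-tabulate⁻ x∈) (inClass⁺ (V H x) (∈-tabulate⁻ x∈) refl))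

    -- Faces may overlap; each vertex takes the index of one face containing it, and subsets of
    -- faces are faces.
    Cov⇒Colourable : ∀ k → Cov k (tabulate (V H)) → Colourable t H k
    Cov⇒Colourable k c with F , face , cover ← faces-of-Cov k c =
      (λ v e → proj₁ (cover v (∈-tabulate⁺ e))) , λ c → Face⇒degenerate _ (Face-⊆ (class⊆ c) (face c))
      where
      class⊆ : ∀ c → class (λ v → inClass (V H v) (λ e → proj₁ (cover v (∈-tabulate⁺ e))) c) ⊆ F c
      class⊆ c {v} v∈ with e , refl ← inClass⁻ (V H v) (proj₂ (class⁻ v∈)) = proj₂ (cover v (∈-tabulate⁺ e))

  -- From graph hypotheses to the complex, and the bound on the order.

  vertices : Subset n
  vertices = tabulate (V G)

  G-Induced : Induced G
  G-Induced = record { V-⊆ = λ _ → id ; μ-≡ = λ _ _ _ _ → refl }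

  -- A path of the t-complement cannot leave `X`: the step out would be an edge of the complex
  -- between separated sets.
  TCompConnected⇒Conn : TCompConnected t G → Conn vertices
  TCompConnected⇒Conn connected X X⊆ (x , x∈) sep y∈ =
    stays (connected x _ (∈-tabulate⁻ (X⊆ x∈)) (∈-tabulate⁻ y∈)) x∈
    where
    stays : ∀ {u v} → Reach (tCompEdge t G) u v → u ∈ X → v ∈ X
    stays here u∈ = u∈
    stays (step {u} {v} (_ , Vv , _ , positive) r) u∈ = stays r (decidable-stable (v ∈? X) λ v∉ →
      sep u u∈ v (x∈p∧x∉q⇒x∈p─q (∈-tabulate⁺ Vv) v∉)
        (Face-pair u v (m∸n≢0⇒n<m (m<n⇒n≢0 positive))))

  -- Deleting `v` gives a proper induced subgraph, whose point partition number is below `k`, hence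
  -- at most `i`.
  Critical⇒Crit : ∀ {k} → Critical t G → IsChi t G k → Crit vertices
  Critical⇒Crit {k} critical isχ v v∈ i c with χ (tabulate (V (induce G (not ∘ λ u → ⌊ u ≟ v ⌋))))
  ... | a , cₐ , a-min = Cov-⊆ i ⊆H (Cov-≤ (s≤s⁻¹ (<-≤-trans a<k k≤)) cₐ)
    where
    H : MGraph n
    H = induce G (λ u → not ⌊ u ≟ v ⌋)
    v∉H : V H v ≢ true
    v∉H e with v ≟ v | ∧-true⁻ {V G v} e
    ... | yes _ | _ , ()
    ... | no v≢v | _ = v≢v refl
    ⊆H : vertices - v ⊆ tabulate (V H)
    ⊆H {u} u∈ = ∈-tabulate⁺ (∧-true⁺ (∈-tabulate⁻ (p─q⊆p vertices ⁅ v ⁆ u∈)) u≠v)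
      where
      u≠v : not ⌊ u ≟ v ⌋ ≡ true
      u≠v with u ≟ v
      ... | yes refl = contradiction (x∈⁅x⁆ u) (x∈p─q⇒x∉q vertices ⁅ u ⁆ u∈)
      ... | no _ = refl
    H-Induced : Induced H
    H-Induced = induce-Induced _
    proper : ProperSub H G
    proper = induce-WF _ WF-G , (V-⊆ H-Induced , μ-induce≤ G (λ u → not ⌊ u ≟ v ⌋)) ,
      λ { (same , _) → v∉H (trans (same v) (∈-tabulate⁻ v∈)) }
    a<k : a < k
    a<k = critical H proper a k
      (Cov⇒Colourable H-Induced a cₐ , λ j → a-min j ∘ Colourable⇒Cov H-Induced j) isχ
    k≤ : k ≤ suc i
    k≤ = proj₂ isχ (suc i) (Cov⇒Colourable G-Induced (suc i) c)

  order-bound : Critical t G → TCompConnected t G → ∀ k → IsChi t G k → 2 * k ∸ 1 ≤ order G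
  order-bound critical connected k isχ
    with k' , c , 2k'≤ ← conn-crit-bound vertices (<-wellFounded _)
           (TCompConnected⇒Conn connected) (Critical⇒Crit critical isχ) = begin
    2 * k ∸ 1        ≤⟨ ∸-monoˡ-≤ 1 (*-monoʳ-≤ 2 (proj₂ isχ k' (Cov⇒Colourable G-Induced k' c))) ⟩
    2 * k' ∸ 1       ≤⟨ ∸-monoˡ-≤ 1 2k'≤ ⟩
    ∣ vertices ∣     ≡⟨ sumF-indicator (V G) ⟨
    order G          ∎
    where open ≤-Reasoning

theorem17 : (t : ℕ) → 1 ≤ t → (n : ℕ) → (G : MGraph n) → WF G →
    Critical t G → TCompConnected t G →
    (k : ℕ) → IsChi t G k → 2 * k ∸ 1 ≤ order G
theorem17 t 1≤t n G wf = Graph.order-bound t 1≤t G wf
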